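{- Let $S = \langle m, n_2,\ldots,n_k\rangle$ be a numerical semigroup, suppose $T = \langle\alpha\rangle+\beta S$ is a monoscopic gluing of $S$, and fix $b\alpha+a\beta,\ b'\alpha+a'\beta\in\operatorname{Ap}(T;\beta m)$, where $a,a'\in\operatorname{Ap}(S;m)$ and $0\le b,b'\le\beta-1$. (a) If $\alpha\notin\operatorname{Ap}(S;m)$, then $b\alpha+a\beta\preceq_T b'\alpha+a'\beta$ if and only if $a\preceq_S a'$ and $b\le b'$. (b) If $\alpha\in\operatorname{Ap}(S;m)$, then $b\alpha+a\beta\preceq_T b'\alpha+a'\beta$ if and only if $a\preceq_S a'$ and either $b\le b'$ or $\alpha\preceq_S a'-a$.
   Context: A numerical semigroup is a subset $S \subseteq \mathbb{Z}_{\ge 0}$ containing $0$, closed under addition, with finite complement; $\langle n_1,\ldots,n_k\rangle$ denotes the set of all non-negative integer combinations of $n_1,\ldots,n_k$. For $m \in S$, $m>0$, the Apéry set is $\operatorname{Ap}(S;m) = \{n \in S : n-m\notin S\}$. For a numerical semigroup $S$, $x\preceq_S y$ means $y-x\in S$. Monoscopic gluing: given a numerical semigroup $S=\langle n_1,\ldots,n_k\rangle$, an integer $\beta\ge 2$, and an element $\alpha\in S\setminus\{n_1,\ldots,n_k\}$ with $\gcd(\alpha,\beta)=1$, the numerical semigroup $T=\langle\alpha\rangle+\beta S=\langle\alpha,\beta n_1,\ldots,\beta n_k\rangle$ is called a monoscopic gluing of $S$ (here $n_1=m$). It is known that $\operatorname{Ap}(T;\beta m)=\{b\alpha+a\beta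 : a\in\operatorname{Ap}(S;m),\ 0\le b\le\beta-1\}$, and each element has a unique such expression. -}

module Defs where

open import Level using (0ℓ)
open import Data.Nat using (ℕ; _+_; _*_; _≤_)
open import Data.Nat.GCD using (gcd)
open import Data.Integer as ℤ using (ℤ; +_)
open import Data.List using (List)
import Data.List.Membership.Propositional as List
open import Data.Vec using (Vec; []; _∷_; sum; zipWith)
import Data.Vec.Membership.Propositional as Vec
open import Data.Product using (_×_; ∃-syntax)
open import Relation.Nullary using (¬_)
open import Relation.Unary using (Pred; _∈_; _⊆_; _≐_; ∁)
open import Relation.Binary.PropositionalEquality using (_≡_)

record IsNumericalSemigroup (S : Pred ℕ 0ℓ) : Set where
  field
    0∈               : 0 ∈ S
    +-closed         : ∀ {x y} → x ∈ S → y ∈ S → (x + y) ∈ S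
    finiteComplement : ∃[ L ] ∁ S ⊆ (List._∈ L)

⟨_⟩ : ∀ {k} → Vec ℕ k → Pred ℕ 0ℓ
⟨_⟩ {k} ns n = ∃[ cs ] n ≡ sum (zipWith {n = k} _*_ cs ns)

infix 4 _∈ᶻ_ _≼[_]_

-- Membership of an integer in a set of naturals.  Differences below are taken
-- in ℤ; truncated subtraction would make negative differences equal to 0,
-- which lies in every numerical semigroup.
_∈ᶻ_ : ℤ → Pred ℕ 0ℓ → Set
z ∈ᶻ S = ∃[ s ] s ∈ S × z ≡ + s

_≼[_]_ : ℤ → Pred ℕ 0ℓ → ℤ → Set
x ≼[ S ] y = (y ℤ.- x) ∈ᶻ S

Ap : Pred ℕ 0ℓ → ℕ → Pred ℕ 0ℓ
Ap S m n = n ∈ S × ¬ ((+ n ℤ.- + m) ∈ᶻ S)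

infixl 6 _⊕_
infixr 7 _⊙_

_⊕_ : Pred ℕ 0ℓ → Pred ℕ 0ℓ → Pred ℕ 0ℓ
(A ⊕ B) n = ∃[ x ] ∃[ y ] x ∈ A × y ∈ B × n ≡ x + y

_⊙_ : ℕ → Pred ℕ 0ℓ → Pred ℕ 0ℓ
(c ⊙ A) n = ∃[ x ] x ∈ A × n ≡ c * x

-- The notion depends on the chosen generators ns of S, since α must not be
-- one of them.
record IsMonoscopicGluing {k} (S : Pred ℕ 0ℓ) (ns : Vec ℕ k) (α β : ℕ)
                          (T : Pred ℕ 0ℓ) : Set where
  field
    generates : S ≐ ⟨ ns ⟩
    2≤β       : 2 ≤ β
    α∈S       : α ∈ S
    α∉ns      : α Vec.∉ ns
    coprime   : gcd α β ≡ 1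
    T≐        : T ≐ ⟨ α ∷ [] ⟩ ⊕ β ⊙ S

{-# OPTIONS --safe #-}

-- An inequality x ≼ y in T amounts to y = x + cα + βs with c ≥ 0 and s ∈ S.
-- Comparing coefficients of α modulo β, for x = bα + aβ and y = b′α + a′β,
-- gives b + c = b′ + qβ and a′ = a + s + qα for some q ≥ 0.  If q = 0 then
-- b ≤ b′ and a ≼ a′ in S; if q ≥ 1 then α ≼ a′ − a in S, which is impossible
-- when α ∉ Ap(S;m), since then a′ − m ∈ S.

module Submission where

open import Level using (0ℓ)
open import Data.Nat using (ℕ; zero; suc; _+_; _*_; _∸_; _≤_; _<_; s≤s; NonZero; >-nonZero)
open import Data.Nat.Coprimality as Coprime using (Coprime; gcd≡1⇒coprime; coprime-divisor)
open import Data.Nat.Divisibility using (_∣_; divides; divides-refl; ∣m+n∣m⇒∣n; n∣m*n; ∣⇒≤)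
open import Data.Nat.Properties
open import Data.Nat.Tactic.RingSolver using (solve-∀)
open import Data.Integer as ℤ using (+_)
import Data.Integer.Properties as ℤ
open import Data.Vec using (Vec; []; _∷_)
open import Data.Product using (_×_; _,_; proj₁; proj₂; ∃-syntax)
open import Data.Sum using (_⊎_; inj₁; inj₂)
open import Function.Base using (case_of_)
open import Function.Bundles using (_⇔_; mk⇔; Equivalence)
open import Relation.Binary.PropositionalEquality
open import Relation.Nullary using (contradiction)
open import Relation.Unary using (Pred; _∈_; _∉_; _≐_)
open import Defs

open Equivalence using (to; from)

-- Here `z` ranges over all integers, so that the equivalence can also be applied with `z` itself a
-- difference; peeling off `w` and then `x` is how `≼-difference⇔∃` is obtained.
z-x≡+s⇔z≡+[s+x] : ∀ z x s → z ℤ.- + x ≡ + s ⇔ z ≡ + (s + x)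
z-x≡+s⇔z≡+[s+x] z x s = mk⇔
  (λ eq → begin
    z                        ≡⟨ ℤ.+-identityʳ z ⟨
    z ℤ.+ ℤ.0ℤ               ≡⟨ cong (ℤ._+_ z) (ℤ.+-inverseˡ (+ x)) ⟨
    z ℤ.+ (ℤ.- + x ℤ.+ + x)  ≡⟨ ℤ.+-assoc z (ℤ.- + x) (+ x) ⟨
    z ℤ.- + x ℤ.+ + x        ≡⟨ cong (ℤ._+ + x) eq ⟩
    + (s + x)                ∎)
  (λ { refl → begin
    + s ℤ.+ + x ℤ.- + x     ≡⟨ ℤ.+-assoc (+ s) (+ x) (ℤ.- + x) ⟩
    + s ℤ.+ (+ x ℤ.- + x)   ≡⟨ cong (ℤ._+_ (+ s)) (ℤ.+-inverseʳ (+ x)) ⟩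
    + s ℤ.+ ℤ.0ℤ            ≡⟨ ℤ.+-identityʳ (+ s) ⟩
    + s                     ∎ })
  where open ≡-Reasoning

≼⇔∃ : ∀ S x y → (+ x ≼[ S ] + y) ⇔ (∃[ s ] s ∈ S × y ≡ s + x)
≼⇔∃ S x y = mk⇔
  (λ (s , s∈S , eq) → s , s∈S , ℤ.+-injective (to (z-x≡+s⇔z≡+[s+x] (+ y) x s) eq))
  (λ (s , s∈S , eq) → s , s∈S , from (z-x≡+s⇔z≡+[s+x] (+ y) x s) (cong +_ eq))

≼-difference⇔∃ : ∀ S w x y →
  (+ w ≼[ S ] (+ y ℤ.- + x)) ⇔ (∃[ s ] s ∈ S × y ≡ s + w + x)
≼-difference⇔∃ S w x y = mk⇔
  (λ (s , s∈S , eq) → s , s∈S ,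
    ℤ.+-injective (to (z-x≡+s⇔z≡+[s+x] (+ y) x (s + w)) (to (z-x≡+s⇔z≡+[s+x] _ w s) eq)))
  (λ (s , s∈S , eq) → s , s∈S ,
    from (z-x≡+s⇔z≡+[s+x] _ w s) (from (z-x≡+s⇔z≡+[s+x] (+ y) x (s + w)) (cong +_ eq)))

*-closed : ∀ {S x} → IsNumericalSemigroup S → x ∈ S → ∀ n → (n * x) ∈ S
*-closed S-semigroup x∈S zero    = IsNumericalSemigroup.0∈ S-semigroup
*-closed S-semigroup x∈S (suc n) =
  IsNumericalSemigroup.+-closed S-semigroup x∈S (*-closed S-semigroup x∈S n)

∈-gluing⇔ : ∀ S α β n →
  n ∈ (⟨ α ∷ [] ⟩ ⊕ β ⊙ S) ⇔ (∃[ c ] ∃[ s ] s ∈ S × n ≡ c * α + β * s)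
∈-gluing⇔ S α β n = mk⇔
  (λ { (_ , _ , (c ∷ [] , refl) , (s , s∈S , refl) , eq) →
       c , s , s∈S , trans eq (cong (_+ β * s) (+-identityʳ (c * α))) })
  (λ { (c , s , s∈S , eq) →
       _ , _ , (c ∷ [] , refl) , (s , s∈S , refl) ,
       trans eq (cong (_+ β * s) (sym (+-identityʳ (c * α)))) })

-- The case u < v cannot occur: β would divide v ∸ u, which lies strictly
-- between 0 and β.
compare-coefficients : ∀ {α β} .{{_ : NonZero β}} → Coprime α β →
  ∀ u v x y → v < β → u * α + x * β ≡ v * α + y * β →
  ∃[ q ] u ≡ q * β + v × y ≡ x + q * α
compare-coefficients {α} {β} cop u v x y v<β eq with ≤-<-connex v u
... | inj₁ v≤u with m≤n⇒∃[o]m+o≡n v≤u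
-- With u = v + d, cancelling vα leaves αd + xβ = yβ. So β divides αd, hence d by coprimality, and q
-- is the quotient d / β.
...   | d , refl = conclude (coprime-divisor (Coprime.sym cop) β∣αd)
  where
  αd+xβ≡yβ : α * d + x * β ≡ y * β
  αd+xβ≡yβ = +-cancelˡ-≡ (v * α) _ _ (trans (rearrange v α d (x * β)) eq)
    where
    rearrange : ∀ v α d z → v * α + (α * d + z) ≡ (v + d) * α + z
    rearrange = solve-∀
  β∣αd : β ∣ α * d
  β∣αd = ∣m+n∣m⇒∣n (divides y (trans (+-comm (x * β) _) αd+xβ≡yβ)) (n∣m*n x)
  conclude : β ∣ d → ∃[ q ] v + d ≡ q * β + v × y ≡ x + q * α
  conclude (divides-refl q) =
    q , +-comm v (q * β) ,
    *-cancelʳ-≡ y (x + q * α) β (trans (sym αd+xβ≡yβ) (rearrange α q β x))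
    where
    rearrange : ∀ α q β x → α * (q * β) + x * β ≡ (x + q * α) * β
    rearrange = solve-∀
compare-coefficients {α} {β} cop u v x y v<β eq | inj₂ u<v with m≤n⇒∃[o]m+o≡n u<v
...   | d , refl = contradiction d<β (≤⇒≯ (∣⇒≤ (coprime-divisor (Coprime.sym cop) β∣αd)))
  where
  -- Since `u < v` means `suc u ≤ v`, the difference v - u is `suc d`. It is visibly nonzero, as
  -- bounding its divisor β by it requires.
  d<β : suc d < β
  d<β = ≤-<-trans (m≤n+m (suc d) u) (subst (_< β) (sym (+-suc u d)) v<β)
  αd+yβ≡xβ : α * suc d + y * β ≡ x * β
  αd+yβ≡xβ = +-cancelˡ-≡ (u * α) _ _ (trans (rearrange u α d (y * β)) (sym eq))
    where
    rearrange : ∀ u α d z → u * α + (α * suc d + z) ≡ (suc u + d) * α + z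
    rearrange = solve-∀
  β∣αd : β ∣ α * suc d
  β∣αd = ∣m+n∣m⇒∣n (divides x (trans (+-comm (y * β) _) αd+yβ≡xβ)) (n∣m*n y)

theorem5p4 : ∀ {k} (S T : Pred ℕ 0ℓ) (m : ℕ) (ns : Vec ℕ k) (α β : ℕ) →
    IsNumericalSemigroup S →
    0 < m →
    S ≐ ⟨ m ∷ ns ⟩ →
    IsMonoscopicGluing S (m ∷ ns) α β T →
    ∀ (a a′ b b′ : ℕ) →
    a ∈ Ap S m → a′ ∈ Ap S m →
    b ≤ β ∸ 1 → b′ ≤ β ∸ 1 →
    (b * α + a * β) ∈ Ap T (β * m) →
    (b′ * α + a′ * β) ∈ Ap T (β * m) →
    (α ∉ Ap S m →
    (+ (b * α + a * β) ≼[ T ] + (b′ * α + a′ * β))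
    ⇔ ((+ a ≼[ S ] + a′) × b ≤ b′))
    ×
    (α ∈ Ap S m →
    (+ (b * α + a * β) ≼[ T ] + (b′ * α + a′ * β))
    ⇔ ((+ a ≼[ S ] + a′) × (b ≤ b′ ⊎ (+ α ≼[ S ] (+ a′ ℤ.- + a)))))
theorem5p4 S T m ns α β S-semigroup _ _ gluing a a′ b b′ (a∈S , _) a′∈Ap b≤β∸1 b′≤β∸1 _ _ =
  -- Both parts rest on `split`; in part (a) its second alternative is refuted by `α∈Ap`.
  (λ α∉Ap → mk⇔
    (λ le → case split le of λ
      { (a≼a′ , inj₁ b≤b′)   → a≼a′ , b≤b′
      ; (a≼a′ , inj₂ α≼a′-a) → contradiction (α∈Ap α≼a′-a) α∉Ap })
    (λ (a≼a′ , b≤b′) → combine a≼a′ b≤b′)) ,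
  (λ _ → mk⇔
    split
    (λ { (a≼a′ , inj₁ b≤b′)   → combine a≼a′ b≤b′
       ; (_    , inj₂ α≼a′-a) → combine-α α≼a′-a }))
  where
  open IsNumericalSemigroup S-semigroup
  open IsMonoscopicGluing gluing

  0<β : 0 < β
  0<β = <-≤-trans 0<1+n 2≤β

  instance
    β≢0 : NonZero β
    β≢0 = >-nonZero 0<β

  b′<β : b′ < β
  b′<β = subst (b′ <_) (m+[n∸m]≡n 0<β) (s≤s b′≤β∸1)

  b≤β : b ≤ β
  b≤β = ≤-trans b≤β∸1 (m∸n≤m β 1)

  x y : ℕ
  x = b * α + a * β
  y = b′ * α + a′ * β

  a≼a′-by : ∀ {s} → s ∈ S → a′ ≡ s + a → + a ≼[ S ] + a′
  a≼a′-by s∈S eq = from (≼⇔∃ S a a′) (_ , s∈S , eq)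

  split : + x ≼[ T ] + y → (+ a ≼[ S ] + a′) × (b ≤ b′ ⊎ (+ α ≼[ S ] (+ a′ ℤ.- + a)))
  split le with to (≼⇔∃ T x y) le
  ... | t , t∈T , y≡t+x with to (∈-gluing⇔ S α β t) (proj₁ T≐ t∈T)
  ...   | c , s , s∈S , refl
        -- The reduced coefficient is b′ < β, whereas b + c may be large; its excess qβ over b′
        -- reappears as qα in a′.
        with compare-coefficients (gcd≡1⇒coprime coprime) (b + c) b′ (a + s) a′ b′<β
               (trans (regroup b c α a s β) (sym y≡t+x))
    where
    regroup : ∀ b c α a s β →
      (b + c) * α + (a + s) * β ≡ (c * α + β * s) + (b * α + a * β)
    regroup = solve-∀
  ...     | zero , b+c≡b′ , a′≡ =
    a≼a′-by s∈S (trans a′≡ (trans (+-identityʳ (a + s)) (+-comm a s))) ,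
    inj₁ (subst (b ≤_) b+c≡b′ (m≤m+n b c))
  -- One of the q + 1 copies of α is set apart: a′ - a - α = s + qα lies in S, and adding α back
  -- gives a′ - a.
  ...     | suc q , _ , a′≡ =
    a≼a′-by (+-closed s+qα∈S α∈S) a′≡s+qα+α+a ,
    inj₂ (from (≼-difference⇔∃ S α a a′) (_ , s+qα∈S , a′≡s+qα+α+a))
    where
    s+qα∈S : (s + q * α) ∈ S
    s+qα∈S = +-closed s∈S (*-closed S-semigroup α∈S q)
    a′≡s+qα+α+a : a′ ≡ s + q * α + α + a
    a′≡s+qα+α+a = trans a′≡ (regroup a s q α)
      where
      regroup : ∀ a s q α → a + s + suc q * α ≡ s + q * α + α + a
      regroup = solve-∀

  x≼y : ∀ c {s} → s ∈ S → y ≡ (c * α + β * s) + x → + x ≼[ T ] + y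
  x≼y c s∈S eq =
    from (≼⇔∃ T x y) (_ , proj₂ T≐ (from (∈-gluing⇔ S α β _) (c , _ , s∈S , refl)) , eq)

  -- The difference y - x is (b′ - b)α + β(a′ - a), with both coefficients available.
  combine : + a ≼[ S ] + a′ → b ≤ b′ → + x ≼[ T ] + y
  combine a≼a′ b≤b′ with to (≼⇔∃ S a a′) a≼a′ | m≤n⇒∃[o]m+o≡n b≤b′
  ... | s , s∈S , a′≡s+a | c , b+c≡b′ = x≼y c s∈S (begin
    b′ * α + a′ * β                       ≡⟨ cong₂ (λ i j → i * α + j * β) (sym b+c≡b′) a′≡s+a ⟩
    (b + c) * α + (s + a) * β             ≡⟨ regroup b c α a s β ⟩
    (c * α + β * s) + (b * α + a * β)     ∎)
    where
    open ≡-Reasoning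
    regroup : ∀ b c α a s β →
      (b + c) * α + (s + a) * β ≡ (c * α + β * s) + (b * α + a * β)
    regroup = solve-∀

  -- The summand α of a′ contributes βα to y, which is β further copies of α. They pay for the b
  -- copies in x even when b > b′: the coefficient of α in y - x becomes b′ + e with e = β - b.
  combine-α : + α ≼[ S ] (+ a′ ℤ.- + a) → + x ≼[ T ] + y
  combine-α α≼a′-a with to (≼-difference⇔∃ S α a a′) α≼a′-a | m≤n⇒∃[o]m+o≡n b≤β
  ... | s , s∈S , a′≡s+α+a | e , b+e≡β = x≼y (b′ + e) s∈S (begin
    b′ * α + a′ * β                            ≡⟨ cong (λ j → b′ * α + j * β) a′≡s+α+a ⟩
    b′ * α + (s + α + a) * β                   ≡⟨ expand b′ s α a β ⟩
    b′ * α + β * α + β * s + a * β             ≡⟨ cong (λ i → b′ * α + i * α + β * s + a * β) (sym b+e≡β) ⟩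
    b′ * α + (b + e) * α + β * s + a * β       ≡⟨ regroup b′ b e α (β * s) (a * β) ⟩
    ((b′ + e) * α + β * s) + (b * α + a * β)   ∎)
    where
    open ≡-Reasoning
    expand : ∀ b′ s α a β → b′ * α + (s + α + a) * β ≡ b′ * α + β * α + β * s + a * β
    expand = solve-∀
    regroup : ∀ b′ b e α u v →
      b′ * α + (b + e) * α + u + v ≡ ((b′ + e) * α + u) + (b * α + v)
    regroup = solve-∀

  -- Apéry sets are closed downward: if α = r + m with r in S, then a′ = (s + r + a) + m,
  -- contradicting that a′ lies in `Ap S m`.
  α∈Ap : + α ≼[ S ] (+ a′ ℤ.- + a) → α ∈ Ap S m
  α∈Ap α≼a′-a = α∈S , λ m≼α → case to (≼-difference⇔∃ S α a a′) α≼a′-a , to (≼⇔∃ S m α) m≼α of λ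
    { ((s , s∈S , a′≡s+α+a) , (r , r∈S , α≡r+m)) →
      proj₂ a′∈Ap (from (≼⇔∃ S m a′)
        (_ , +-closed (+-closed s∈S r∈S) a∈S ,
         trans a′≡s+α+a (trans (cong (λ i → s + i + a) α≡r+m) (regroup s r m a)))) }
    where
    regroup : ∀ s r m a → s + (r + m) + a ≡ s + r + a + m
    regroup = solve-∀
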